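{- $(\overline{\mathcal{G}(\mathcal{T})},\preceq,\bot,\top)$ is a complete lattice.
   Context: $C$ is a countable set of constants, $X$ a countable set of variables, and $\mathcal{T}$ is the set of formal expressions (terms) given by $t::=c\mid x\mid (t+t)$ with $c\in C$, $x\in X$. For a partition $\mathcal{P}$ of $\mathcal{T}$ write $t\cong_{\mathcal{P}}t'$ if $t,t'$ lie in the same class. $\mathcal{P}$ is a congruence if: (1) distinct constants $c\neq c'$ satisfy $c\ncong_{\mathcal P} c'$; (2) for all $t,t',s,s'\in\mathcal{T}$, ($t'\cong_{\mathcal P} t$ and $s'\cong_{\mathcal P} s$) if and only if $t'+s'\cong_{\mathcal P} t+s$; (3) for $c\in C$, $t\in\mathcal{T}$, if $t\cong_{\mathcal P} c$ then $t=c$ or $t\in X$. $\mathcal{G}(\mathcal{T})$ is the set of all congruences, ordered by refinement: $\mathcal{P}\preceq\mathcal{P}'$ if each class of $\mathcal{P}$ is contained in some class of $\mathcal{P}'$. $\bot=\{\{t\}:t\in\mathcal{T}\}$ is the partition into singletons. $\overline{\mathcal{G}(\mathcal{T})}=\mathcal{G}(\mathcal{T})\cup\{\top\}$, where $\top$ is an artificially added element with $\mathcal{P}\preceq\top$ for every $\mathcal{P}\in\overline{\mathcal{G}(\mathcal{T})}$. $\bot$ and $\top$ are the claimed least and greatest elements; a complete lattice is one in which every subset has a greatest lower bound and a least upper bound. -}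

module Defs where

open import Data.Nat.Base using (ℕ)
open import Data.Product.Base using (Σ; ∃; _×_; _,_; proj₁; proj₂)
open import Data.Sum.Base using (_⊎_; inj₁)
open import Function.Base using (_on_)
open import Function.Bundles using (_⇔_; _↣_; mk⇔)
open import Level using (Level; 0ℓ; _⊔_) renaming (suc to lsuc)
open import Relation.Binary.Core using (Rel)
open import Relation.Binary.Definitions using (Minimum; Maximum; _Respects_)
open import Relation.Binary.PropositionalEquality.Core
  using (_≡_; _≢_; refl; sym; trans; cong₂)
open import Relation.Binary.Structures using (IsPartialOrder)
open import Relation.Nullary.Construct.Add.Supremum using (_⁺; [_]; ⊤⁺)
open import Relation.Nullary.Negation.Core using (¬_)
open import Relation.Unary using (Pred; _∈_; _⊆_; _≐_; _≬_; ｛_｝; Satisfiable)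
import Relation.Binary.Construct.Add.Supremum.Equality as AddEquality
import Relation.Binary.Construct.Add.Supremum.NonStrict as AddOrder

-- Finite or countably infinite.
Countable : Set → Set
Countable A = A ↣ ℕ

module _ {a ℓ₂} {A : Set a} (_≤_ : Rel A ℓ₂) where

  IsLowerBound : ∀ {ℓ} → Pred A ℓ → A → Set (a ⊔ ℓ₂ ⊔ ℓ)
  IsLowerBound S x = ∀ {y} → y ∈ S → x ≤ y

  IsUpperBound : ∀ {ℓ} → Pred A ℓ → A → Set (a ⊔ ℓ₂ ⊔ ℓ)
  IsUpperBound S x = ∀ {y} → y ∈ S → y ≤ x

  IsInfimum : ∀ {ℓ} → Pred A ℓ → A → Set (a ⊔ ℓ₂ ⊔ ℓ)
  IsInfimum S x = IsLowerBound S x × (∀ {z} → IsLowerBound S z → z ≤ x)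

  IsSupremum : ∀ {ℓ} → Pred A ℓ → A → Set (a ⊔ ℓ₂ ⊔ ℓ)
  IsSupremum S x = IsUpperBound S x × (∀ {z} → IsUpperBound S z → x ≤ z)

-- ℓ is the universe level of the predicates representing subsets.  They are
-- not required to respect _≈_: a subset and its closure under _≈_ have the
-- same lower and upper bounds.
record IsCompleteLattice {a ℓ₁ ℓ₂} (ℓ : Level) {A : Set a}
         (_≈_ : Rel A ℓ₁) (_≤_ : Rel A ℓ₂) (⊥ ⊤ : A)
         : Set (a ⊔ ℓ₁ ⊔ ℓ₂ ⊔ lsuc ℓ) where
  field
    isPartialOrder : IsPartialOrder _≈_ _≤_
    minimum        : Minimum _≤_ ⊥
    maximum        : Maximum _≤_ ⊤
    infimum        : (S : Pred A ℓ) → ∃ (IsInfimum _≤_ S)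
    supremum       : (S : Pred A ℓ) → ∃ (IsSupremum _≤_ S)

-- A partition is a set of subsets; subsets with the same elements are
-- identified, hence `respects`.
record Partition (A : Set) : Set₁ where
  field
    Class    : Pred (Pred A 0ℓ) 0ℓ
    respects : Class Respects _≐_
    nonempty : ∀ {K} → K ∈ Class → Satisfiable K
    covers   : ∀ x → ∃ λ K → K ∈ Class × x ∈ K
    disjoint : ∀ {K L} → K ∈ Class → L ∈ Class → K ≬ L → K ≐ L

open Partition using (Class)

module _ {A : Set} where

  infix 4 _≈ᴾ_ _⪯ᴾ_

  _≈ᴾ_ : Rel (Partition A) (lsuc 0ℓ)
  P ≈ᴾ Q = Class P ≐ Class Q

  _⪯ᴾ_ : Rel (Partition A) (lsuc 0ℓ)
  P ⪯ᴾ Q = ∀ {K} → K ∈ Class P → ∃ λ L → L ∈ Class Q × K ⊆ L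

  SameClass : Partition A → Rel A (lsuc 0ℓ)
  SameClass P x y = ∃ λ K → K ∈ Class P × x ∈ K × y ∈ K

  singletons : Partition A
  singletons = record
    { Class    = λ K → ∃ λ x → K ≐ ｛ x ｝
    ; respects = λ (K⊆L , L⊆K) (x , K⊆x , x⊆K) →
                   x , (λ y∈L → K⊆x (L⊆K y∈L)) , (λ x≡y → K⊆L (x⊆K x≡y))
    ; nonempty = λ (x , _ , x⊆K) → x , x⊆K refl
    ; covers   = λ x → ｛ x ｝ , (x , (λ p → p) , (λ p → p)) , refl
    ; disjoint = λ (x , K⊆x , x⊆K) (y , L⊆y , y⊆L) (z , z∈K , z∈L) →
        (λ w∈K → y⊆L (trans (L⊆y z∈L) (trans (sym (K⊆x z∈K)) (K⊆x w∈K)))) ,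
        (λ w∈L → x⊆K (trans (K⊆x z∈K) (trans (sym (L⊆y z∈L)) (L⊆y w∈L))))
    }

  singletons-≡ : ∀ {x y} → SameClass singletons x y → x ≡ y
  singletons-≡ (_ , (_ , K⊆z , _) , x∈K , y∈K) = trans (sym (K⊆z x∈K)) (K⊆z y∈K)

  ≡-singletons : ∀ {x y} → x ≡ y → SameClass singletons x y
  ≡-singletons {x} x≡y = ｛ x ｝ , (x , (λ p → p) , (λ p → p)) , refl , x≡y

infixl 6 _⊕_

data Term (C X : Set) : Set where
  con : C → Term C X
  var : X → Term C X
  _⊕_ : Term C X → Term C X → Term C X

module _ {C X : Set} where

  record IsCongruence (P : Partition (Term C X)) : Set₁ where
    infix 4 _≅_
    _≅_ : Rel (Term C X) (lsuc 0ℓ)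
    _≅_ = SameClass P
    field
      con-distinct : ∀ {c c′} → c ≢ c′ → ¬ (con c ≅ con c′)
      ⊕-cong       : ∀ t t′ s s′ → (t′ ≅ t × s′ ≅ s) ⇔ (t′ ⊕ s′ ≅ t ⊕ s)
      con-class    : ∀ c t → t ≅ con c → t ≡ con c ⊎ ∃ λ x → t ≡ var x

  singletons-isCongruence : IsCongruence singletons
  singletons-isCongruence = record
    { con-distinct = λ c≢c′ p → c≢c′ (con-injective (singletons-≡ p))
    ; ⊕-cong       = λ t t′ s s′ → mk⇔
        (λ (p , q) → ≡-singletons (cong₂ _⊕_ (singletons-≡ p) (singletons-≡ q)))
        (λ p → let (q , r) = ⊕-injective (singletons-≡ p)
               in ≡-singletons q , ≡-singletons r)
    ; con-class    = λ c t p → inj₁ (singletons-≡ p)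
    }
    where
    con-injective : ∀ {c c′ : C} → _≡_ {A = Term C X} (con c) (con c′) → c ≡ c′
    con-injective refl = refl

    ⊕-injective : ∀ {t t′ s s′ : Term C X} → t′ ⊕ s′ ≡ t ⊕ s → t′ ≡ t × s′ ≡ s
    ⊕-injective refl = refl , refl

𝒢 : Set → Set → Set₁
𝒢 C X = Σ (Partition (Term C X)) IsCongruence

𝒢⁺ : Set → Set → Set₁
𝒢⁺ C X = 𝒢 C X ⁺

module _ {C X : Set} where

  open AddEquality {A = 𝒢 C X} (_≈ᴾ_ on proj₁) public using () renaming (_≈⁺_ to _≈_)
  open AddOrder {A = 𝒢 C X} (_⪯ᴾ_ on proj₁) public using () renaming (_≤⁺_ to _⪯_)

  ⊥𝒢 : 𝒢⁺ C X
  ⊥𝒢 = [ singletons , singletons-isCongruence ]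

  ⊤𝒢 : 𝒢⁺ C X
  ⊤𝒢 = ⊤⁺

{-# OPTIONS --safe #-}
-- Read a partition as the equivalence relation SameClass: refinement is then
-- inclusion of relations, and each congruence axiom passes to the intersection
-- of a nonempty family of congruences.  That intersection is the infimum; the
-- infimum of a subset with no element besides ⊤ is ⊤.  Suprema are infima of
-- sets of upper bounds.
module Submission where

open import Defs
open import Axiom.ExcludedMiddle using (ExcludedMiddle)
open import Data.Product.Base using (∃; _,_; proj₁; proj₂)
open import Function.Base using (id; _∘_; _on_)
open import Function.Bundles using (mk⇔; module Equivalence)
open import Level using (Level; 0ℓ; _⊔_) renaming (suc to lsuc)
open import Relation.Binary.Core using (Rel)
open import Relation.Binary.Definitions using (Reflexive; Symmetric; Transitive; Minimum)
open import Relation.Binary.PropositionalEquality.Core using (subst)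
open import Relation.Binary.Structures using (IsEquivalence; IsPartialOrder)
open import Relation.Nullary.Construct.Add.Supremum using ([_]; ⊤⁺)
open import Relation.Nullary.Decidable.Core
  using (yes; no; True; toWitness; fromWitness)
open import Relation.Nullary.Negation.Core using (contradiction)
open import Relation.Unary using (Pred; _∈_; _⊆_; _≐_)
open import Relation.Unary.Properties using (≐-refl; ≐-sym; ≐-trans)
import Relation.Binary.Construct.Add.Supremum.NonStrict as AddOrder
import Relation.Binary.Construct.On as On

open Partition

module _ {A : Set} where

  SameClass-refl : (P : Partition A) → Reflexive (SameClass P)
  SameClass-refl P {x} = let (K , K∈P , x∈K) = covers P x in K , K∈P , x∈K , x∈K

  SameClass-sym : (P : Partition A) → Symmetric (SameClass P)
  SameClass-sym P (K , K∈P , x∈K , y∈K) = K , K∈P , y∈K , x∈K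

  SameClass-trans : (P : Partition A) → Transitive (SameClass P)
  SameClass-trans P (K , K∈P , x∈K , y∈K) (L , L∈P , y∈L , z∈L) =
    K , K∈P , x∈K , proj₂ (disjoint P K∈P L∈P (_ , y∈K , y∈L)) z∈L

  ⪯ᴾ⇒SameClass : ∀ {P Q : Partition A} → P ⪯ᴾ Q →
                 ∀ {x y} → SameClass P x y → SameClass Q x y
  ⪯ᴾ⇒SameClass P⪯Q (K , K∈P , x∈K , y∈K) =
    let (L , L∈Q , K⊆L) = P⪯Q K∈P in L , L∈Q , K⊆L x∈K , K⊆L y∈K

  -- Fix `x` in the nonempty class `K` and let `L` be the class of `x` in `Q`. Each `y` in `K`
  -- shares a class of `Q` with `x`; that class meets `L` in `x`, so it has the elements of `L`.
  SameClass⇒⪯ᴾ : ∀ {P Q : Partition A} →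
                 (∀ {x y} → SameClass P x y → SameClass Q x y) → P ⪯ᴾ Q
  SameClass⇒⪯ᴾ {P} {Q} P⇒Q {K} K∈P =
    let (x , x∈K)       = nonempty P K∈P
        (L , L∈Q , x∈L) = covers Q x
    in L , L∈Q , λ y∈K →
      let (M , M∈Q , x∈M , y∈M) = P⇒Q (K , K∈P , x∈K , y∈K)
      in proj₁ (disjoint Q M∈Q L∈Q (x , x∈M , x∈L)) y∈M

  -- A squeeze: `K ⊆ L ⊆ M` where `K` and `M` are classes of `P` with a common point, so all three
  -- have the same elements.
  ⪯ᴾ-antisym-⊆ : ∀ {P Q : Partition A} → P ⪯ᴾ Q → Q ⪯ᴾ P → Class P ⊆ Class Q
  ⪯ᴾ-antisym-⊆ {P} {Q} P⪯Q Q⪯P K∈P =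
    let (L , L∈Q , K⊆L) = P⪯Q K∈P
        (M , M∈P , L⊆M) = Q⪯P L∈Q
        (x , x∈K)       = nonempty P K∈P
        (_ , M⊆K)       = disjoint P K∈P M∈P (x , x∈K , L⊆M (K⊆L x∈K))
    in respects Q ((λ y∈L → M⊆K (L⊆M y∈L)) , K⊆L) L∈Q

  ⪯ᴾ-isPartialOrder : IsPartialOrder (_≈ᴾ_ {A = A}) _⪯ᴾ_
  ⪯ᴾ-isPartialOrder = record
    { isPreorder = record
      { isEquivalence = record
        { refl  = ≐-refl
        ; sym   = ≐-sym
        ; trans = ≐-trans
        }
      ; reflexive = λ (P⊆Q , _) {K} K∈P → K , P⊆Q K∈P , id
      ; trans     = λ P⪯Q Q⪯R K∈P →
          let (L , L∈Q , K⊆L) = P⪯Q K∈P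
              (M , M∈R , L⊆M) = Q⪯R L∈Q
          in M , M∈R , L⊆M ∘ K⊆L
      }
    ; antisym = λ {P} {Q} P⪯Q Q⪯P →
        ⪯ᴾ-antisym-⊆ {P} {Q} P⪯Q Q⪯P , ⪯ᴾ-antisym-⊆ {Q} {P} Q⪯P P⪯Q
    }

  singletons-minimum : Minimum _⪯ᴾ_ (singletons {A = A})
  singletons-minimum P = SameClass⇒⪯ᴾ {singletons} {P} λ {x} x≅y →
    subst (SameClass P x) (singletons-≡ x≅y) (SameClass-refl P)

  module _ {R : Rel A 0ℓ} (R-isEquivalence : IsEquivalence R) where

    private module R = IsEquivalence R-isEquivalence

    quotient : Partition A
    quotient = record
      { Class    = λ K → ∃ λ x → K ≐ R x
      ; respects = λ K≐L (x , K≐Rx) → x , ≐-trans (≐-sym K≐L) K≐Rx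
      ; nonempty = λ (x , _ , Rx⊆K) → x , Rx⊆K R.refl
      ; covers   = λ x → R x , (x , ≐-refl) , R.refl
      ; disjoint = λ (x , K⊆Rx , Rx⊆K) (y , L⊆Ry , Ry⊆L) (z , z∈K , z∈L) →
          let Rxy = R.trans (K⊆Rx z∈K) (R.sym (L⊆Ry z∈L)) in
          (λ w∈K → Ry⊆L (R.trans (R.sym Rxy) (K⊆Rx w∈K))) ,
          (λ w∈L → Rx⊆K (R.trans Rxy (L⊆Ry w∈L)))
      }

    SameClass-quotient⁺ : ∀ {x y} → R x y → SameClass quotient x y
    SameClass-quotient⁺ {x} Rxy = R x , (x , ≐-refl) , R.refl , Rxy

    SameClass-quotient⁻ : ∀ {x y} → SameClass quotient x y → R x y
    SameClass-quotient⁻ (_ , (_ , K⊆Rz , _) , x∈K , y∈K) =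
      R.trans (R.sym (K⊆Rz x∈K)) (K⊆Rz y∈K)

-- The intersection quantifies over partitions, so it lives in a large universe,
-- while classes are small predicates; deciding it with excluded middle and
-- taking True of the decision brings it down to Set.
module Intersection {A : Set} {i} {I : Set i} (P : I → Partition A)
                    (em : ExcludedMiddle (lsuc 0ℓ ⊔ i)) where

  InAll : Rel A (lsuc 0ℓ ⊔ i)
  InAll x y = ∀ i → SameClass (P i) x y

  _∼_ : Rel A 0ℓ
  x ∼ y = True (em {InAll x y})

  ∼-isEquivalence : IsEquivalence _∼_
  ∼-isEquivalence = record
    { refl  = fromWitness λ i → SameClass-refl (P i)
    ; sym   = λ p → fromWitness λ i → SameClass-sym (P i) (toWitness p i)
    ; trans = λ p q → fromWitness λ i →
                SameClass-trans (P i) (toWitness p i) (toWitness q i)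
    }

  ⋂ : Partition A
  ⋂ = quotient ∼-isEquivalence

  SameClass-⋂⁺ : ∀ {x y} → InAll x y → SameClass ⋂ x y
  SameClass-⋂⁺ p = SameClass-quotient⁺ ∼-isEquivalence (fromWitness p)

  SameClass-⋂⁻ : ∀ {x y} → SameClass ⋂ x y → InAll x y
  SameClass-⋂⁻ p = toWitness (SameClass-quotient⁻ ∼-isEquivalence p)

  ⋂-lower : ∀ i → ⋂ ⪯ᴾ P i
  ⋂-lower i = SameClass⇒⪯ᴾ {P = ⋂} {Q = P i} λ p → SameClass-⋂⁻ p i

  ⋂-greatest : ∀ {Q} → (∀ i → Q ⪯ᴾ P i) → Q ⪯ᴾ ⋂
  ⋂-greatest {Q} Q⪯P = SameClass⇒⪯ᴾ {P = Q} {Q = ⋂} λ p →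
    SameClass-⋂⁺ λ i → ⪯ᴾ⇒SameClass {P = Q} {Q = P i} (Q⪯P i) p

module _ {C X : Set} where

  -- The equivalence in `⊕-cong` survives a conjunction over all indices. The other two axioms
  -- restrict which terms may be related, so they are inherited from any single member. This is
  -- where `i₀` enters: an empty intersection relates all terms, which breaks `con-class` once there
  -- is a constant.
  ⋂-isCongruence : ∀ {i} {I : Set i} (P : I → Partition (Term C X))
                   (em : ExcludedMiddle (lsuc 0ℓ ⊔ i)) → I →
                   (∀ i → IsCongruence (P i)) →
                   IsCongruence (Intersection.⋂ P em)
  ⋂-isCongruence P em i₀ P-cong = record
    { con-distinct = λ c≢c′ p → P₀.con-distinct c≢c′ (SameClass-⋂⁻ p i₀)
    ; ⊕-cong       = λ t t′ s s′ →
        let module E i = Equivalence (IsCongruence.⊕-cong (P-cong i) t t′ s s′) in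
        mk⇔ (λ (p , q) → SameClass-⋂⁺ λ i →
               E.to i (SameClass-⋂⁻ p i , SameClass-⋂⁻ q i))
            (λ p → SameClass-⋂⁺ (λ i → proj₁ (E.from i (SameClass-⋂⁻ p i))) ,
                   SameClass-⋂⁺ (λ i → proj₂ (E.from i (SameClass-⋂⁻ p i))))
    ; con-class    = λ c t p → P₀.con-class c t (SameClass-⋂⁻ p i₀)
    }
    where
    open Intersection P em
    module P₀ = IsCongruence (P-cong i₀)

  𝒢⁺-infimum : ∀ {ℓ} → ExcludedMiddle (lsuc 0ℓ ⊔ ℓ) →
               (S : Pred (𝒢⁺ C X) ℓ) → ∃ (IsInfimum _⪯_ S)
  𝒢⁺-infimum em S with em {∃ λ P → [ P ] ∈ S}
  ... | no ∄P = ⊤𝒢 , lower , λ _ → _ AddOrder.≤⊤⁺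
    where
    lower : IsLowerBound _⪯_ S ⊤𝒢
    lower {⊤⁺}    _   = _ AddOrder.≤⊤⁺
    lower {[ P ]} P∈S = contradiction (P , P∈S) ∄P
  -- The family is indexed by the congruences in `S` together with their membership proofs; `P₀`
  -- witnesses that it is nonempty.
  ... | yes P₀ = [ ⋂ , ⋂-isCongruence family em P₀ (proj₂ ∘ proj₁) ] , lower , greatest
    where
    family : (∃ λ P → [ P ] ∈ S) → Partition (Term C X)
    family = proj₁ ∘ proj₁

    open Intersection family em

    lower : IsLowerBound _⪯_ S _
    lower {⊤⁺}    _   = _ AddOrder.≤⊤⁺
    lower {[ P ]} P∈S = AddOrder.[ ⋂-lower (P , P∈S) ]

    greatest : ∀ {Q} → IsLowerBound _⪯_ S Q → Q ⪯ _
    -- `⊤⁺` is no lower bound here, since it would lie below the congruence in `P₀`.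
    greatest {⊤⁺}    ⊤⪯S with () ← ⊤⪯S (proj₂ P₀)
    greatest {[ Q ]} Q⪯S = AddOrder.[ ⋂-greatest {proj₁ Q} (λ (_ , P∈S) →
      AddOrder.[≤]-injective (_⪯ᴾ_ on proj₁) (Q⪯S P∈S)) ]

module _ {a ℓ₂} {A : Set a} (_≤_ : Rel A ℓ₂) where

  -- Each element of `S` is a lower bound of the set of upper bounds, hence lies below its infimum.
  infimum-upperBounds⇒supremum : ∀ {ℓ} {S : Pred A ℓ} {x} →
    IsInfimum _≤_ (IsUpperBound _≤_ S) x → IsSupremum _≤_ S x
  infimum-upperBounds⇒supremum (lower , greatest) =
    (λ y∈S → greatest λ z-upper → z-upper y∈S) , λ z-upper → lower z-upper

theorem4p8 : (ℓ : Level) → ExcludedMiddle (lsuc 0ℓ ⊔ ℓ) →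
    (C X : Set) → Countable C → Countable X →
    IsCompleteLattice ℓ {A = 𝒢⁺ C X} _≈_ _⪯_ ⊥𝒢 ⊤𝒢
theorem4p8 ℓ em C X _ _ = record
  -- Pulling back along `proj₁` compares congruences by their partitions alone, so antisymmetry
  -- never has to identify proofs of `IsCongruence`.
  { isPartialOrder = AddOrder.≤⁺-isPartialOrder _ (On.isPartialOrder proj₁ ⪯ᴾ-isPartialOrder)
  ; minimum        = λ where
      ⊤⁺    → _ AddOrder.≤⊤⁺
      [ P ] → AddOrder.[ singletons-minimum (proj₁ P) ]
  ; maximum        = AddOrder.≤⁺-maximum _
  ; infimum        = 𝒢⁺-infimum em
  ; supremum       = λ S →
      -- The upper bounds form a predicate at level `lsuc 0ℓ ⊔ ℓ`, which may exceed `ℓ`; joining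
      -- with `lsuc 0ℓ` again changes nothing, so the same `em` applies.
      let (x , x-inf) = 𝒢⁺-infimum em (IsUpperBound _⪯_ S)
      in x , infimum-upperBounds⇒supremum _⪯_ x-inf
  }
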